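{- Linear optimization over the partitioning orbitope $O^{=}_{p,q}$ can be solved in time $O(pq)$: there is an algorithm that, given integers $p\ge q\ge 1$ and an objective vector $d\in\mathbb{R}^{\mathcal{I}_{p,q}}$, computes in time $O(pq)$ an optimal solution of $\max\{\langle d,x\rangle : x\in O^{=}_{p,q}\}$.
   Context: Notation: $[n]=\{1,\dots,n\}$, $\mathcal{I}_{p,q}=\{(i,j)\in[p]\times[q] : i\ge j\}$. The partitioning orbitope $O^{=}_{p,q}$ is the convex hull of all 0/1-matrices of size $p\times q$ whose columns are in lexicographically decreasing (i.e., non-increasing, with row 1 the most significant position) order and that have exactly one 1-entry per row. Since no such matrix has a 1 above its main diagonal, the entries $(i,j)$ with $i<j$ are dropped and $O^{=}_{p,q}$ is regarded as a subset of $\mathbb{R}^{\mathcal{I}_{p,q}}$. Time is measured as the number of elementary operations, where arithmetic operations on and comparisons of real numbers have unit cost. -}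

module Defs where

open import Algebra.Bundles using (CommutativeRing)
open import Data.Bool.Base as Bool using (Bool; true; false; if_then_else_; _∧_)
open import Data.Fin.Base as Fin using (Fin; toℕ)
open import Data.Nat.Base as ℕ using (ℕ; _≡ᵇ_)
import Data.Fin.Properties as Fin
import Data.Nat.Properties as ℕ
open import Data.Product.Base using (Σ-syntax; ∃-syntax; _×_; _,_)
open import Data.Product using (∃!)
import Data.Vec.Base as Vec
open import Data.Vec.Relation.Binary.Lex.Strict using (Lex-≤)
open import Level using (Level; suc; _⊔_)
open import Relation.Binary.Core using (Rel)
open import Relation.Binary.Structures using (IsDecTotalOrder)
open import Relation.Binary.PropositionalEquality.Core using (_≡_; refl; sym; trans)
open import Relation.Nullary.Decidable.Core using (does; yes; no)
open import Relation.Nullary.Negation.Core using (¬_)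

------------------------------------------------------------------------
-- Scalars

-- The library has no real numbers; an arbitrary ordered field plays their
-- role (classically, the reals are one).  The order is decidable because comparing two reals is an elementary
-- operation of the machine below.  Inversion is made total by 0⁻¹ = 0.
record OrderedField c ℓ₁ ℓ₂ : Set (suc (c ⊔ ℓ₁ ⊔ ℓ₂)) where
  infix  4 _≤_
  infixl 7 _÷_
  infix  8 _⁻¹
  field
    commutativeRing : CommutativeRing c ℓ₁
  open CommutativeRing commutativeRing public
  field
    _≤_             : Rel Carrier ℓ₂
    isDecTotalOrder : IsDecTotalOrder _≈_ _≤_
    +-monoˡ-≤       : ∀ z {x y} → x ≤ y → x + z ≤ y + z
    *-nonNeg        : ∀ {x y} → 0# ≤ x → 0# ≤ y → 0# ≤ x * y
    0≉1             : ¬ 0# ≈ 1#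
    _⁻¹             : Carrier → Carrier
    ⁻¹-cong         : ∀ {x y} → x ≈ y → x ⁻¹ ≈ y ⁻¹
    ⁻¹-inverseʳ     : ∀ {x} → ¬ x ≈ 0# → x * x ⁻¹ ≈ 1#
    0⁻¹≈0           : 0# ⁻¹ ≈ 0#

  open IsDecTotalOrder isDecTotalOrder public using (_≤?_)

  _÷_ : Carrier → Carrier → Carrier
  x ÷ y = x * y ⁻¹

------------------------------------------------------------------------
-- Programs of a real random access machine

-- Memory consists of arrays of natural numbers and arrays of reals.  An array
-- name is part of the program text, so a program uses finitely many arrays; a
-- position within an array is computed at run time.  There is no
-- multiplication of natural numbers, so that arithmetic on long integers
-- cannot be hidden in a unit-cost operation.

infixl 6 _:+_ _:∸_ _:-_
infixl 7 _:*_ _:÷_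
infix  4 _:≤_
infixr 1 _⨾_

data IntExp : Set where
  nat  : ℕ → IntExp
  int  : (array : ℕ) (index : IntExp) → IntExp
  _:+_ _:∸_ : IntExp → IntExp → IntExp

data RealExp : Set where
  zero one : RealExp
  real : (array : ℕ) (index : IntExp) → RealExp
  _:+_ _:-_ _:*_ _:÷_ : RealExp → RealExp → RealExp

data Test : Set where
  _:≤_   : IntExp → IntExp → Test
  _:≤ʳ_  : RealExp → RealExp → Test

data Program : Set where
  skip    : Program
  setInt  : (array : ℕ) (index value : IntExp) → Program
  setReal : (array : ℕ) (index : IntExp) (value : RealExp) → Program
  _⨾_     : Program → Program → Program
  cond    : Test → Program → Program → Program
  while   : Test → Program → Program

-- The number of elementary operations in one evaluation.

intCost : IntExp → ℕ
intCost (nat n)   = 1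
intCost (int a e) = 1 ℕ.+ intCost e
intCost (e :+ f)  = 1 ℕ.+ (intCost e ℕ.+ intCost f)
intCost (e :∸ f)  = 1 ℕ.+ (intCost e ℕ.+ intCost f)

realCost : RealExp → ℕ
realCost zero       = 1
realCost one        = 1
realCost (real a e) = 1 ℕ.+ intCost e
realCost (e :+ f)   = 1 ℕ.+ (realCost e ℕ.+ realCost f)
realCost (e :- f)   = 1 ℕ.+ (realCost e ℕ.+ realCost f)
realCost (e :* f)   = 1 ℕ.+ (realCost e ℕ.+ realCost f)
realCost (e :÷ f)   = 1 ℕ.+ (realCost e ℕ.+ realCost f)

testCost : Test → ℕ
testCost (e :≤ f)  = 1 ℕ.+ (intCost e ℕ.+ intCost f)
testCost (e :≤ʳ f) = 1 ℕ.+ (realCost e ℕ.+ realCost f)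

update : ∀ {a} {A : Set a} → (ℕ → ℕ → A) → ℕ → ℕ → A → (ℕ → ℕ → A)
update m a k v a′ k′ = if (a ≡ᵇ a′) ∧ (k ≡ᵇ k′) then v else m a′ k′

module _ {c ℓ₁ ℓ₂} (ℝ : OrderedField c ℓ₁ ℓ₂) where
  open OrderedField ℝ hiding (refl; sym; trans)
  open import Algebra.Definitions.RawMonoid +-rawMonoid using (sum)

  ----------------------------------------------------------------------
  -- Execution

  record State : Set c where
    constructor state
    field
      ints  : ℕ → ℕ → ℕ
      reals : ℕ → ℕ → Carrier
  open State

  evalInt : State → IntExp → ℕ
  evalInt s (nat n)   = n
  evalInt s (int a e) = ints s a (evalInt s e)
  evalInt s (e :+ f)  = evalInt s e ℕ.+ evalInt s f
  evalInt s (e :∸ f)  = evalInt s e ℕ.∸ evalInt s f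

  evalReal : State → RealExp → Carrier
  evalReal s zero       = 0#
  evalReal s one        = 1#
  evalReal s (real a e) = reals s a (evalInt s e)
  evalReal s (e :+ f)   = evalReal s e + evalReal s f
  evalReal s (e :- f)   = evalReal s e - evalReal s f
  evalReal s (e :* f)   = evalReal s e * evalReal s f
  evalReal s (e :÷ f)   = evalReal s e ÷ evalReal s f

  evalTest : State → Test → Bool
  evalTest s (e :≤ f)  = does (evalInt s e ℕ.≤? evalInt s f)
  evalTest s (e :≤ʳ f) = does (evalReal s e ≤? evalReal s f)

  -- Run P s t s′: started in s, P halts in s′ after t elementary operations.
  data Run : Program → State → ℕ → State → Set c where

    skip : ∀ {s} → Run skip s 1 s

    setInt : ∀ {a e f s} →
      Run (setInt a e f) s (1 ℕ.+ (intCost e ℕ.+ intCost f))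
        (record s { ints = update (ints s) a (evalInt s e) (evalInt s f) })

    setReal : ∀ {a e f s} →
      Run (setReal a e f) s (1 ℕ.+ (intCost e ℕ.+ realCost f))
        (record s { reals = update (reals s) a (evalInt s e) (evalReal s f) })

    _⨾_ : ∀ {P Q s s′ s″ t u} →
      Run P s t s′ → Run Q s′ u s″ → Run (P ⨾ Q) s (t ℕ.+ u) s″

    cond-true : ∀ {b P Q s s′ t} → evalTest s b ≡ true →
      Run P s t s′ → Run (cond b P Q) s (1 ℕ.+ (testCost b ℕ.+ t)) s′

    cond-false : ∀ {b P Q s s′ t} → evalTest s b ≡ false →
      Run Q s t s′ → Run (cond b P Q) s (1 ℕ.+ (testCost b ℕ.+ t)) s′

    while-true : ∀ {b P s s′ s″ t u} → evalTest s b ≡ true →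
      Run P s t s′ → Run (while b P) s′ u s″ →
      Run (while b P) s (1 ℕ.+ (testCost b ℕ.+ (t ℕ.+ u))) s″

    while-false : ∀ {b P s} → evalTest s b ≡ false →
      Run (while b P) s (1 ℕ.+ testCost b) s

  Run-deterministic : ∀ {P s t u s′ s″} →
    Run P s t s′ → Run P s u s″ → t ≡ u × s′ ≡ s″
  Run-deterministic skip    skip    = refl , refl
  Run-deterministic setInt  setInt  = refl , refl
  Run-deterministic setReal setReal = refl , refl
  Run-deterministic (r₁ ⨾ r₂) (r₁′ ⨾ r₂′)
    with refl , refl ← Run-deterministic r₁ r₁′
    with refl , refl ← Run-deterministic r₂ r₂′ = refl , refl
  Run-deterministic (cond-true _ r) (cond-true _ r′)
    with refl , refl ← Run-deterministic r r′ = refl , refl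
  Run-deterministic (cond-false _ r) (cond-false _ r′)
    with refl , refl ← Run-deterministic r r′ = refl , refl
  Run-deterministic (cond-true e _) (cond-false e′ _)
    with () ← trans (sym e) e′
  Run-deterministic (cond-false e _) (cond-true e′ _)
    with () ← trans (sym e) e′
  Run-deterministic (while-true _ r₁ r₂) (while-true _ r₁′ r₂′)
    with refl , refl ← Run-deterministic r₁ r₁′
    with refl , refl ← Run-deterministic r₂ r₂′ = refl , refl
  Run-deterministic (while-false _) (while-false _) = refl , refl
  Run-deterministic (while-true e _ _) (while-false e′)
    with () ← trans (sym e) e′
  Run-deterministic (while-false e) (while-true e′ _ _)
    with () ← trans (sym e) e′

  ----------------------------------------------------------------------
  -- Polytopes

  Conv : ∀ {i v} {I : Set i} →
         ((I → Carrier) → Set v) → (I → Carrier) → Set (c ⊔ ℓ₁ ⊔ ℓ₂ ⊔ i ⊔ v)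
  Conv {I = I} V x =
    Σ[ n ∈ ℕ ] Σ[ w ∈ (Fin n → Carrier) ] Σ[ v ∈ (Fin n → I → Carrier) ]
      (∀ k → 0# ≤ w k) ×
      sum w ≈ 1# ×
      (∀ k → V (v k)) ×
      (∀ e → x e ≈ sum (λ k → w k * v k e))

  -- ℝ^ℐ; the pair (i , j) belongs to ℐ when j ≤ i.
  Vector : ℕ → ℕ → Set c
  Vector p q = (i : Fin p) (j : Fin q) → .(j Fin.≤ i) → Carrier

  zeroExtend : ∀ {p q} → Vector p q → Fin p → Fin q → Carrier
  zeroExtend x i j with j Fin.≤? i
  ... | yes j≤i = x i j j≤i
  ... | no  _   = 0#

  ⟨_,_⟩ : ∀ {p q} → Vector p q → Vector p q → Carrier
  ⟨ d , x ⟩ = sum λ i → sum λ j → zeroExtend d i j * zeroExtend x i j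

  column : ∀ {p q} → (Fin p → Fin q → Bool) → Fin q → Vec.Vec Bool p
  column M j = Vec.tabulate λ i → M i j

  IsVertex : ∀ {p q} → (Fin p → Fin q → Bool) → Set
  IsVertex M =
    (∀ j j′ → j Fin.≤ j′ → Lex-≤ _≡_ Bool._<_ (column M j′) (column M j)) ×
    (∀ i → ∃! _≡_ λ j → M i j ≡ true)

  Vertex : ∀ {p q} → (Fin p × Fin q → Carrier) → Set ℓ₁
  Vertex {p} {q} v = ∃[ M ] (IsVertex {p} {q} M ×
    (∀ i j → v (i , j) ≈ (if M i j then 1# else 0#)))

  -- The orbitope is a polytope in ℝ^(p×q) whose coordinates outside ℐ are
  -- dropped.
  PartitioningOrbitope : ∀ p q → Vector p q → Set (c ⊔ ℓ₁ ⊔ ℓ₂)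
  PartitioningOrbitope p q x = ∃[ y ] (Conv (Vertex {p} {q}) y ×
    (∀ i j .(j≤i : j Fin.≤ i) → x i j j≤i ≈ y (i , j)))

  Optimal : ∀ {p q} → Vector p q → Vector p q → Set (c ⊔ ℓ₁ ⊔ ℓ₂)
  Optimal {p} {q} d x =
    PartitioningOrbitope p q x ×
    (∀ y → PartitioningOrbitope p q y → ⟨ d , y ⟩ ≤ ⟨ d , x ⟩)

  ----------------------------------------------------------------------
  -- Input and output

  -- Row-major layout with rows of length q.  Positions that correspond to no
  -- element of ℐ are unconstrained.
  Stores : ∀ {p q} → State → (array : ℕ) → Vector p q → Set ℓ₁
  Stores {p} {q} s a x = ∀ i j .(j≤i : j Fin.≤ i) →
    reals s a (toℕ i ℕ.* q ℕ.+ toℕ j) ≈ x i j j≤i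

  -- Memory not mentioned here may have arbitrary initial contents.
  record Input (p q : ℕ) (d : Vector p q) (s : State) : Set ℓ₁ where
    field
      rows      : ints s 0 0 ≡ p
      columns   : ints s 1 0 ≡ q
      objective : Stores s 0 d

  Output : ∀ p q → Vector p q → State → Set ℓ₁
  Output p q x s = Stores s 1 x

{-# OPTIONS --safe #-}

-- A vertex of the orbitope assigns to each row i a column e i; lexicographic
-- order of the columns says that a column is used for the first time only
-- after its left neighbour.  So the columns available to a row are 0, …, k for
-- some state k, and k increases (up to q − 1) exactly when column k is chosen.
-- The best total of the rows from i on, as a function of k, satisfies the
-- recursion
--   V i k = max (max_{j ≤ k} d i j + V (i + 1) k , d i k + V (i + 1) (k + 1)),
-- whose inner maxima are prefix maxima of row i, so all p q values are found in
-- time O(p q).  Staying in state k after choosing column k only forgoes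
-- options, hence may be allowed.
module Submission where

open import Defs
import Algebra.Properties.CommutativeMonoid.Sum as CommutativeMonoidSum
import Algebra.Properties.Ring as RingProperties
import Algebra.Properties.Semiring.Sum as SemiringSum
open import Data.Bool.Base as Bool using (Bool; true; false; if_then_else_; T; _∧_; f<t)
open import Data.Bool.Properties using (T-∧)
open import Data.Fin.Base as Fin using (Fin; zero; suc; toℕ; fromℕ<)
import Data.Fin.Properties as Fin
open import Data.Nat.Base
  using (ℕ; zero; suc; _+_; _*_; _∸_; _≤_; _<_; z≤n; s≤s; z<s; s<s; s≤s⁻¹; _≡ᵇ_; >-nonZero)
open import Data.Nat.Induction using (<-rec)
open import Data.Nat.Properties
open import Data.Nat.Tactic.RingSolver using (solve-∀)
open import Data.Product.Base using (Σ-syntax; ∃-syntax; _×_; _,_; proj₁; proj₂)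
open import Data.Sum.Base using (_⊎_; inj₁; inj₂)
open import Data.Unit.Base using (tt)
open import Data.Vec.Base using (tabulate)
open import Data.Vec.Relation.Binary.Lex.Strict using (Lex-≤; base; this; next)
open import Function.Bundles using (Equivalence)
open import Relation.Binary.Bundles using (Poset)
open import Relation.Binary.PropositionalEquality.Core
  using (_≡_; _≢_; refl; sym; trans; cong; cong₂; subst)
open import Relation.Binary.Structures using (IsDecTotalOrder)
open import Relation.Nullary.Decidable using (dec-true; dec-false)
open import Relation.Nullary.Decidable.Core using (does; yes; no)
open import Relation.Nullary.Negation.Core using (contradiction)

-- Boolean equality of natural numbers

≡⇒≡ᵇ-true : ∀ {m n} → m ≡ n → (m ≡ᵇ n) ≡ true
≡⇒≡ᵇ-true {m} {n} = dec-true (m ≟ n)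

≢⇒≡ᵇ-false : ∀ {m n} → m ≢ n → (m ≡ᵇ n) ≡ false
≢⇒≡ᵇ-false {m} {n} = dec-false (m ≟ n)

≡ᵇ-true⇒≡ : ∀ {m n} → (m ≡ᵇ n) ≡ true → m ≡ n
≡ᵇ-true⇒≡ {m} {n} eq = ≡ᵇ⇒≡ m n (subst T (sym eq) tt)

true≢false : true ≢ false
true≢false ()

-- Vertices as restricted growth functions

-- At the first difference the smaller sequence `f` is false and `g` is true. Position `i` is a
-- difference of the opposite kind, so the first one lies before it.
Lex≤⇒earlier-true : ∀ {n} (f g : Fin n → Bool) →
  Lex-≤ _≡_ Bool._<_ (tabulate f) (tabulate g) →
  ∀ i → f i ≡ true → g i ≡ false → ∃[ i′ ] (i′ Fin.< i × g i′ ≡ true)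
Lex≤⇒earlier-true f g (this f₀<g₀ _) i fi gi = first i fi (strict f₀<g₀)
  where
  strict : ∀ {x y} → x Bool.< y → x ≡ false × y ≡ true
  strict f<t = refl , refl
  first : ∀ i → f i ≡ true → f zero ≡ false × g zero ≡ true →
          ∃[ i′ ] (i′ Fin.< i × g i′ ≡ true)
  first zero    f₀ (f₀′ , _) = contradiction (trans (sym f₀) f₀′) true≢false
  first (suc i) _  (_ , g₀)  = zero , z<s , g₀
Lex≤⇒earlier-true f g (next f₀≡g₀ _) zero f₀ g₀ =
  contradiction (trans (sym f₀) (trans f₀≡g₀ g₀)) true≢false
Lex≤⇒earlier-true f g (next _ rest) (suc i) fi gi
  with i′ , i′<i , gi′ ← Lex≤⇒earlier-true (λ t → f (suc t)) (λ t → g (suc t)) rest i fi gi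
  = suc i′ , s<s i′<i , gi′

-- If `g` is true somewhere, its first `true` precedes every `true` of `f` and is the first
-- difference; otherwise both sequences are constantly false.
earlier-true⇒Lex≤ : ∀ {n} (f g : Fin n → Bool) →
  (∀ i → f i ≡ true → ∃[ i′ ] (i′ Fin.< i × g i′ ≡ true)) →
  Lex-≤ _≡_ Bool._<_ (tabulate f) (tabulate g)
earlier-true⇒Lex≤ {zero}  f g h = base tt
earlier-true⇒Lex≤ {suc n} f g h with f zero in f₀ | g zero in g₀
... | true  | _     with () ← proj₁ (proj₂ (h zero f₀))
... | false | true  = this f<t refl
... | false | false = next refl (earlier-true⇒Lex≤ _ _ later)
  where
  later : ∀ i → f (suc i) ≡ true → ∃[ i′ ] (i′ Fin.< i × g (suc i′) ≡ true)
  later i fi with h (suc i) fi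
  ... | zero   , _        , gi′ = contradiction (trans (sym gi′) g₀) true≢false
  ... | suc i′ , s≤s i′<i , gi′ = i′ , i′<i , gi′

Lex≤-refl : ∀ {n} (f : Fin n → Bool) → Lex-≤ _≡_ Bool._<_ (tabulate f) (tabulate f)
Lex≤-refl {zero}  f = base tt
Lex≤-refl {suc n} f = next refl (Lex≤-refl _)

-- Restricted growth strings: partitions of the rows into at most `q` blocks, numbered by first
-- occurrence. Only rows below `p` are constrained, so that row arithmetic can stay in `ℕ`.
record RestrictedGrowth (p q : ℕ) (e : ℕ → ℕ) : Set where
  field
    bounded     : ∀ {i} → i < p → e i < q
    predecessor : ∀ {i j} → i < p → e i ≡ suc j → ∃[ i′ ] (i′ < i × e i′ ≡ j)

  -- Column `suc j` requires an earlier row with column `j`, so values rise no faster than the row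
  -- index. Hence every 1 of the matrix lies on or below the diagonal.
  below-diagonal : ∀ i → i < p → e i ≤ i
  below-diagonal = <-rec (λ i → i < p → e i ≤ i) step
    where
    step : ∀ i → (∀ {i′} → i′ < i → i′ < p → e i′ ≤ i′) → i < p → e i ≤ i
    step i ih i<p with e i in ei
    ... | zero  = z≤n
    ... | suc j with i′ , i′<i , refl ← predecessor i<p ei
                = ≤-<-trans (ih i′<i (<-trans i′<i i<p)) i′<i

  -- Repeated use of `predecessor` descends one column at a time and so meets `j`.
  ancestor : ∀ {i j j′} → i < p → e i ≡ j′ → j < j′ → ∃[ i′ ] (i′ < i × e i′ ≡ j)
  ancestor {i} {j} {suc j′} i<p ei (s≤s j≤j′)
    with i₁ , i₁<i , ei₁ ← predecessor i<p ei
    with m≤n⇒m<n∨m≡n j≤j′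
  ... | inj₂ refl = i₁ , i₁<i , ei₁
  ... | inj₁ j<j′ with i′ , i′<i₁ , ei′ ← ancestor (<-trans i₁<i i<p) ei₁ j<j′
                  = i′ , <-trans i′<i₁ i₁<i , ei′

code : ∀ {p q} → (ℕ → ℕ) → Fin p → Fin q → Bool
code e i j = toℕ j ≡ᵇ e (toℕ i)

module _ {c ℓ₁ ℓ₂} (ℝ : OrderedField c ℓ₁ ℓ₂) {p q : ℕ} where

  -- For `j < j′`, `ancestor` puts a 1 of column `j` above every 1 of column `j′`, which makes
  -- column `j′` lexicographically smaller.
  restrictedGrowth⇒vertex : ∀ {e} → RestrictedGrowth p q e → IsVertex ℝ {p} {q} (code e)
  restrictedGrowth⇒vertex {e} rg = sorted , unique
    where
    open RestrictedGrowth rg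
    sorted : ∀ j j′ → j Fin.≤ j′ →
             Lex-≤ _≡_ Bool._<_ (column ℝ {p} {q} (code e) j′) (column ℝ (code e) j)
    sorted j j′ j≤j′ with m≤n⇒m<n∨m≡n j≤j′
    ... | inj₂ j≡j′ rewrite Fin.toℕ-injective j≡j′ = Lex≤-refl _
    ... | inj₁ j<j′ = earlier-true⇒Lex≤ _ _ earlier
      where
      earlier : ∀ i → code e i j′ ≡ true → ∃[ i′ ] (i′ Fin.< i × code e i′ j ≡ true)
      earlier i eq
        with i′ , i′<i , ei′ ← ancestor (Fin.toℕ<n i) (sym (≡ᵇ-true⇒≡ eq)) j<j′
        = fromℕ< i′<p
        , subst (_< toℕ i) (sym (Fin.toℕ-fromℕ< i′<p)) i′<i
        , ≡⇒≡ᵇ-true (trans (sym ei′) (cong e (sym (Fin.toℕ-fromℕ< i′<p))))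
        where i′<p = <-trans i′<i (Fin.toℕ<n i)
    unique : ∀ i → Σ[ j ∈ Fin q ]
      (code e i j ≡ true × (∀ {j′} → code e i j′ ≡ true → j ≡ j′))
    unique i = fromℕ< ei<q , ≡⇒≡ᵇ-true (Fin.toℕ-fromℕ< ei<q) , λ eq →
      Fin.toℕ-injective (trans (Fin.toℕ-fromℕ< ei<q) (sym (≡ᵇ-true⇒≡ eq)))
      where ei<q = bounded (Fin.toℕ<n i)

  -- `e i` is the column of the only 1 in row `i`. If this is `suc j`, column `j` has a 0 there, so
  -- the order of the two columns forces an earlier 1 in column `j`.
  vertex⇒restrictedGrowth : ∀ {M} → IsVertex ℝ {p} {q} M →
    ∃[ e ] (RestrictedGrowth p q e × (∀ i j → M i j ≡ code e i j))
  vertex⇒restrictedGrowth {M} (sorted , unique) =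
    e , record { bounded = bounded ; predecessor = predecessor } , coded
    where
    col : Fin p → Fin q
    col i = proj₁ (unique i)

    col-only : ∀ {i j} → M i j ≡ true → col i ≡ j
    col-only {i} = proj₂ (proj₂ (unique i))

    e : ℕ → ℕ
    e n with n <? p
    ... | yes n<p = toℕ (col (fromℕ< n<p))
    ... | no  _   = 0

    e-toℕ : ∀ i → e (toℕ i) ≡ toℕ (col i)
    e-toℕ i with toℕ i <? p
    ... | yes i<p = cong (λ t → toℕ (col t)) (Fin.fromℕ<-toℕ i i<p)
    ... | no  i≮p = contradiction (Fin.toℕ<n i) i≮p

    e-< : ∀ {n} (n<p : n < p) → e n ≡ toℕ (col (fromℕ< n<p))
    e-< n<p = trans (cong e (sym (Fin.toℕ-fromℕ< n<p))) (e-toℕ (fromℕ< n<p))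

    bounded : ∀ {i} → i < p → e i < q
    bounded i<p rewrite e-< i<p = Fin.toℕ<n _

    predecessor : ∀ {i j} → i < p → e i ≡ suc j → ∃[ i′ ] (i′ < i × e i′ ≡ j)
    predecessor {i} {j} i<p ei =
      toℕ i′ , subst (toℕ i′ <_) (Fin.toℕ-fromℕ< i<p) i′<i ,
      trans (e-toℕ i′) (trans (cong toℕ (col-only Mi′)) j⁻≡j)
      where
      i° = fromℕ< i<p
      col-i : toℕ (col i°) ≡ suc j
      col-i = trans (sym (e-< i<p)) ei
      j<q : j < q
      j<q = <-trans (subst (j <_) (sym col-i) (n<1+n j)) (Fin.toℕ<n (col i°))
      j⁻ = fromℕ< j<q
      j⁻≡j : toℕ j⁻ ≡ j
      j⁻≡j = Fin.toℕ-fromℕ< j<q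
      Mij⁻ : M i° j⁻ ≡ false
      Mij⁻ with M i° j⁻ in eq
      ... | false = refl
      ... | true  = contradiction (trans (sym col-i) (trans (cong toℕ (col-only eq)) j⁻≡j)) 1+n≢n
      earlier : ∃[ i′ ] (i′ Fin.< i° × M i′ j⁻ ≡ true)
      earlier = Lex≤⇒earlier-true (λ t → M t (col i°)) (λ t → M t j⁻)
        (sorted j⁻ (col i°) (subst (_≤ toℕ (col i°)) (sym j⁻≡j) (subst (j ≤_) (sym col-i) (n≤1+n j))))
        i° (proj₁ (proj₂ (unique i°))) Mij⁻
      i′ = proj₁ earlier
      i′<i = proj₁ (proj₂ earlier)
      Mi′ = proj₂ (proj₂ earlier)

    coded : ∀ i j → M i j ≡ code e i j
    coded i j with M i j in eq
    ... | true  = sym (≡⇒≡ᵇ-true (trans (cong toℕ (sym (col-only eq))) (sym (e-toℕ i))))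
    ... | false = sym (≢⇒≡ᵇ-false λ j≡e → true≢false (trans (sym (proj₁ (proj₂ (unique i))))
      (trans (cong (M i) (Fin.toℕ-injective (trans (sym (e-toℕ i)) (sym j≡e)))) eq)))

-- Sums over an ordered field

module OrderedSums {c ℓ₁ ℓ₂} (ℝ : OrderedField c ℓ₁ ℓ₂) where
  open OrderedField ℝ public
    using (Carrier; _≈_; 0#; 1#; -_)
    renaming (_+_ to _+ᴿ_; _*_ to _*ᴿ_; _≤_ to _≤ᴿ_; _≤?_ to _≤ᴿ?_)
  open OrderedField ℝ
    using (reflexive; semiring; ring; isDecTotalOrder; *-nonNeg)
    renaming ( +-monoˡ-≤ to +ᴿ-monoˡ-≤; +-cong to +ᴿ-cong; *-cong to *ᴿ-cong; +-identityˡ to +ᴿ-identityˡ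
             ; +-identityʳ to +ᴿ-identityʳ; *-identityˡ to *ᴿ-identityˡ; *-identityʳ to *ᴿ-identityʳ
             ; +-comm to +ᴿ-comm; +-assoc to +ᴿ-assoc; zeroˡ to *ᴿ-zeroˡ; zeroʳ to *ᴿ-zeroʳ
             ; *-comm to *ᴿ-comm; *-assoc to *ᴿ-assoc
             ; -‿inverseʳ to -ᴿ-inverseʳ; -‿inverseˡ to -ᴿ-inverseˡ; distribˡ to *ᴿ-distribˡ
             ; +-commutativeMonoid to +ᴿ-commutativeMonoid
             ; refl to ≈-refl; sym to ≈-sym; trans to ≈-trans) public
  open IsDecTotalOrder isDecTotalOrder public using ()
    renaming (refl to ≤ᴿ-refl; trans to ≤ᴿ-trans; total to ≤ᴿ-total)

  ≤ᴿ-poset : Poset c ℓ₁ ℓ₂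
  ≤ᴿ-poset = record { isPartialOrder = IsDecTotalOrder.isPartialOrder isDecTotalOrder }

  module ≤ᴿ-Reasoning where
    open import Relation.Binary.Reasoning.PartialOrder ≤ᴿ-poset public

  open CommutativeMonoidSum +ᴿ-commutativeMonoid public
    using (sum; sum-cong-≋; sum-replicate-zero; ∑-comm)
  open SemiringSum semiring public using (*-distribˡ-sum; *-distribʳ-sum)

  +ᴿ-mono-≤ : ∀ {x y u v} → x ≤ᴿ y → u ≤ᴿ v → (x +ᴿ u) ≤ᴿ (y +ᴿ v)
  +ᴿ-mono-≤ {x} {y} {u} {v} x≤y u≤v = begin
    x +ᴿ u  ≤⟨ +ᴿ-monoˡ-≤ u x≤y ⟩
    y +ᴿ u  ≈⟨ +ᴿ-comm y u ⟩
    u +ᴿ y  ≤⟨ +ᴿ-monoˡ-≤ y u≤v ⟩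
    v +ᴿ y  ≈⟨ +ᴿ-comm v y ⟩
    y +ᴿ v  ∎
    where open ≤ᴿ-Reasoning

  -- `w y` equals `w (y - x) + w x`, and the first summand is a product of non-negative factors.
  *ᴿ-monoʳ-≤-nonNeg : ∀ {w x y} → 0# ≤ᴿ w → x ≤ᴿ y → (w *ᴿ x) ≤ᴿ (w *ᴿ y)
  *ᴿ-monoʳ-≤-nonNeg {w} {x} {y} 0≤w x≤y = begin
    w *ᴿ x                        ≈⟨ +ᴿ-identityˡ _ ⟨
    0# +ᴿ w *ᴿ x                  ≤⟨ +ᴿ-monoˡ-≤ _ (*-nonNeg 0≤w 0≤y-x) ⟩
    w *ᴿ (y +ᴿ - x) +ᴿ w *ᴿ x     ≈⟨ *ᴿ-distribˡ w _ x ⟨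
    w *ᴿ (y +ᴿ - x +ᴿ x)          ≈⟨ *ᴿ-cong ≈-refl (+ᴿ-assoc y (- x) x) ⟩
    w *ᴿ (y +ᴿ (- x +ᴿ x))        ≈⟨ *ᴿ-cong ≈-refl (+ᴿ-cong ≈-refl (-ᴿ-inverseˡ x)) ⟩
    w *ᴿ (y +ᴿ 0#)                ≈⟨ *ᴿ-cong ≈-refl (+ᴿ-identityʳ y) ⟩
    w *ᴿ y                        ∎
    where
    open ≤ᴿ-Reasoning
    0≤y-x : 0# ≤ᴿ (y +ᴿ - x)
    0≤y-x = begin
      0#         ≈⟨ -ᴿ-inverseʳ x ⟨
      x +ᴿ - x   ≤⟨ +ᴿ-monoˡ-≤ (- x) x≤y ⟩
      y +ᴿ - x   ∎

  -- If 1 were at most 0, then -1 would be non-negative, and so would its square 1.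
  0≤1 : 0# ≤ᴿ 1#
  0≤1 with ≤ᴿ-total 0# 1#
  ... | inj₁ 0≤1 = 0≤1
  ... | inj₂ 1≤0 = begin
    0#              ≤⟨ *-nonNeg 0≤-1 0≤-1 ⟩
    - 1# *ᴿ - 1#    ≈⟨ -‿distribˡ-* 1# (- 1#) ⟨
    - (1# *ᴿ - 1#)  ≈⟨ -‿cong (*ᴿ-identityˡ (- 1#)) ⟩
    - - 1#          ≈⟨ -‿involutive 1# ⟩
    1#              ∎
    where
    open ≤ᴿ-Reasoning
    open OrderedField ℝ using (-‿cong)
    open RingProperties ring using (-‿distribˡ-*; -‿involutive)
    0≤-1 : 0# ≤ᴿ - 1#
    0≤-1 = begin
      0#          ≈⟨ -ᴿ-inverseʳ 1# ⟨
      1# +ᴿ - 1#  ≤⟨ +ᴿ-monoˡ-≤ (- 1#) 1≤0 ⟩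
      0# +ᴿ - 1#  ≈⟨ +ᴿ-identityˡ (- 1#) ⟩
      - 1#        ∎

  sum-mono-≤ : ∀ {n} (f g : Fin n → Carrier) → (∀ k → f k ≤ᴿ g k) → sum f ≤ᴿ sum g
  sum-mono-≤ {zero}  f g f≤g = ≤ᴿ-refl
  sum-mono-≤ {suc n} f g f≤g = +ᴿ-mono-≤ (f≤g zero) (sum-mono-≤ _ _ λ k → f≤g (suc k))

  sum-≈0 : ∀ {n} (f : Fin n → Carrier) → (∀ k → f k ≈ 0#) → sum f ≈ 0#
  sum-≈0 {n} f f≈0 = ≈-trans (sum-cong-≋ f≈0) (sum-replicate-zero n)

  sum-single : ∀ {n} (f : Fin n → Carrier) k → (∀ j → j ≢ k → f j ≈ 0#) → sum f ≈ f k
  sum-single f zero    z = ≈-trans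
    (+ᴿ-cong ≈-refl (sum-≈0 (λ j → f (suc j)) λ j → z (suc j) λ ()))
    (+ᴿ-identityʳ (f zero))
  sum-single f (suc k) z = ≈-trans
    (+ᴿ-cong (z zero λ ()) (sum-single (λ j → f (suc j)) k λ j j≢k →
      z (suc j) λ eq → j≢k (Fin.suc-injective eq)))
    (+ᴿ-identityˡ (f (suc k)))

  -- Transfers a bound on the vertices to their convex combinations.
  sum-weighted-≤ : ∀ {n} (w f : Fin n → Carrier) {b} → (∀ k → 0# ≤ᴿ w k) → sum w ≈ 1# →
                   (∀ k → f k ≤ᴿ b) → sum (λ k → w k *ᴿ f k) ≤ᴿ b
  sum-weighted-≤ w f {b} 0≤w Σw f≤b = begin
    sum (λ k → w k *ᴿ f k)  ≤⟨ sum-mono-≤ _ _ (λ k → *ᴿ-monoʳ-≤-nonNeg (0≤w k) (f≤b k)) ⟩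
    sum (λ k → w k *ᴿ b)    ≈⟨ *-distribʳ-sum b w ⟨
    sum w *ᴿ b              ≈⟨ *ᴿ-cong Σw ≈-refl ⟩
    1# *ᴿ b                 ≈⟨ *ᴿ-identityˡ b ⟩
    b                       ∎
    where open ≤ᴿ-Reasoning

  total : (ℕ → Carrier) → ℕ → ℕ → Carrier
  total f zero    i = 0#
  total f (suc r) i = f i +ᴿ total f r (suc i)

  sum≈total : ∀ f r i → sum {r} (λ t → f (i + toℕ t)) ≈ total f r i
  sum≈total f zero    i = ≈-refl
  sum≈total f (suc r) i = +ᴿ-cong (reflexive (cong f (+-identityʳ i))) (≈-trans
    (sum-cong-≋ {r} λ t → reflexive (cong f (+-suc i (toℕ t))))
    (sum≈total f r (suc i)))

-- Linear functionals on the orbitope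

module Objective {c ℓ₁ ℓ₂} (ℝ : OrderedField c ℓ₁ ℓ₂) {p q} (d : Vector ℝ p q) where
  open OrderedSums ℝ

  -- The objective on full matrices; the zero extension of `d` annihilates the entries above the
  -- diagonal, so restricting a matrix keeps its value.
  ⟨d,_⟩ : (Fin p × Fin q → Carrier) → Carrier
  ⟨d, y ⟩ = sum λ i → sum λ j → zeroExtend ℝ d i j *ᴿ y (i , j)

  restriction-value : ∀ x y → (∀ i j .(j≤i : j Fin.≤ i) → x i j j≤i ≈ y (i , j)) →
                      ⟨_,_⟩ ℝ d x ≈ ⟨d, y ⟩
  restriction-value x y x≈y = sum-cong-≋ λ i → sum-cong-≋ λ j → entry i j
    where
    entry : ∀ i j → (zeroExtend ℝ d i j *ᴿ zeroExtend ℝ x i j) ≈ (zeroExtend ℝ d i j *ᴿ y (i , j))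
    entry i j with j Fin.≤? i
    ... | yes j≤i = *ᴿ-cong ≈-refl (x≈y i j j≤i)
    ... | no  _   = ≈-trans (*ᴿ-zeroˡ _) (≈-sym (*ᴿ-zeroˡ _))

  -- Linearity: the finite sums are interchanged until the sum over `k` is outermost.
  combination-value : ∀ {n} (w : Fin n → Carrier) (v : Fin n → Fin p × Fin q → Carrier) y →
    (∀ e → y e ≈ sum (λ k → w k *ᴿ v k e)) → ⟨d, y ⟩ ≈ sum (λ k → w k *ᴿ ⟨d, v k ⟩)
  combination-value {n} w v y y≈ = begin-equality
    sum {p} (λ i → sum {q} (λ j → D i j *ᴿ y (i , j)))
      ≈⟨ sum-cong-≋ (λ i → sum-cong-≋ (λ j → expand i j)) ⟩
    sum {p} (λ i → sum {q} (λ j → sum {n} (λ k → w k *ᴿ (D i j *ᴿ v k (i , j)))))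
      ≈⟨ sum-cong-≋ (λ i → ∑-comm {q} {n} (λ j k → w k *ᴿ (D i j *ᴿ v k (i , j)))) ⟩
    sum {p} (λ i → sum {n} (λ k → sum {q} (λ j → w k *ᴿ (D i j *ᴿ v k (i , j)))))
      ≈⟨ ∑-comm {p} {n} (λ i k → sum {q} (λ j → w k *ᴿ (D i j *ᴿ v k (i , j)))) ⟩
    sum {n} (λ k → sum {p} (λ i → sum {q} (λ j → w k *ᴿ (D i j *ᴿ v k (i , j)))))
      ≈⟨ sum-cong-≋ (λ k → sum-cong-≋ (λ i → *-distribˡ-sum (w k) (λ j → D i j *ᴿ v k (i , j)))) ⟨
    sum {n} (λ k → sum {p} (λ i → w k *ᴿ sum {q} (λ j → D i j *ᴿ v k (i , j))))
      ≈⟨ sum-cong-≋ (λ k → *-distribˡ-sum (w k) (λ i → sum {q} (λ j → D i j *ᴿ v k (i , j)))) ⟨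
    sum {n} (λ k → w k *ᴿ ⟨d, v k ⟩) ∎
    where
    open ≤ᴿ-Reasoning
    D = zeroExtend ℝ d
    expand : ∀ i j → (D i j *ᴿ y (i , j)) ≈ sum {n} (λ k → w k *ᴿ (D i j *ᴿ v k (i , j)))
    expand i j = begin-equality
      D i j *ᴿ y (i , j)                               ≈⟨ *ᴿ-cong ≈-refl (y≈ (i , j)) ⟩
      D i j *ᴿ sum (λ k → w k *ᴿ v k (i , j))          ≈⟨ *-distribˡ-sum (D i j) (λ k → w k *ᴿ v k (i , j)) ⟩
      sum (λ k → D i j *ᴿ (w k *ᴿ v k (i , j)))        ≈⟨ sum-cong-≋ (λ k → swap (D i j) (w k) (v k (i , j))) ⟩
      sum {n} (λ k → w k *ᴿ (D i j *ᴿ v k (i , j)))    ∎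
      where
      swap : ∀ a b x → (a *ᴿ (b *ᴿ x)) ≈ (b *ᴿ (a *ᴿ x))
      swap a b x = ≈-trans (≈-sym (*ᴿ-assoc a b x))
        (≈-trans (*ᴿ-cong (*ᴿ-comm a b) ≈-refl) (*ᴿ-assoc b a x))

  -- In row `i` only column `e i` can contribute, and `below-diagonal` places that entry where `D`
  -- agrees with `d`.
  code-value : ∀ {e} (D : ℕ → ℕ → Carrier) →
    (∀ i j .(j≤i : j Fin.≤ i) → D (toℕ i) (toℕ j) ≈ d i j j≤i) →
    RestrictedGrowth p q e →
    ∀ v → (∀ i j → v (i , j) ≈ (if code e i j then 1# else 0#)) →
    ⟨d, v ⟩ ≈ total (λ i → D i (e i)) p 0
  code-value {e} D D≈d rg v v≈ =
    ≈-trans (sum-cong-≋ row) (sum≈total (λ i → D i (e i)) p 0)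
    where
    open RestrictedGrowth rg
    row : ∀ i → sum (λ j → zeroExtend ℝ d i j *ᴿ v (i , j)) ≈ D (toℕ i) (e (toℕ i))
    row i = ≈-trans (sum-single _ k off) on
      where
      k : Fin q
      k = fromℕ< (bounded (Fin.toℕ<n i))
      k≡e : toℕ k ≡ e (toℕ i)
      k≡e = Fin.toℕ-fromℕ< _
      k≤i : k Fin.≤ i
      k≤i = subst (_≤ toℕ i) (sym k≡e) (below-diagonal (toℕ i) (Fin.toℕ<n i))
      off : ∀ j → j ≢ k → (zeroExtend ℝ d i j *ᴿ v (i , j)) ≈ 0#
      off j j≢k with v≈ i j
      ... | v≈ij rewrite ≢⇒≡ᵇ-false {toℕ j} {e (toℕ i)} (λ eq → j≢k (Fin.toℕ-injective (trans eq (sym k≡e)))) =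
        ≈-trans (*ᴿ-cong ≈-refl v≈ij) (*ᴿ-zeroʳ _)
      on : (zeroExtend ℝ d i k *ᴿ v (i , k)) ≈ D (toℕ i) (e (toℕ i))
      on with v≈ i k | k Fin.≤? i
      ... | _    | no  k≰i = contradiction k≤i k≰i
      ... | v≈ik | yes le rewrite ≡⇒≡ᵇ-true {toℕ k} {e (toℕ i)} k≡e = begin-equality
        d i k le *ᴿ v (i , k)   ≈⟨ *ᴿ-cong ≈-refl v≈ik ⟩
        d i k le *ᴿ 1#          ≈⟨ *ᴿ-identityʳ _ ⟩
        d i k le                ≈⟨ D≈d i k le ⟨
        D (toℕ i) (toℕ k)       ≈⟨ reflexive (cong (D (toℕ i)) k≡e) ⟩
        D (toℕ i) (e (toℕ i))   ∎
        where open ≤ᴿ-Reasoning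

-- Dynamic program

module Choice {c ℓ₁ ℓ₂} (ℝ : OrderedField c ℓ₁ ℓ₂) (q : ℕ) where
  open OrderedSums ℝ

  -- The machine has no minimum; the truncated subtractions clamp 1 + k to q ∸ 1.
  grow : ℕ → ℕ
  grow k = (q ∸ 1) ∸ ((q ∸ 1) ∸ suc k)

  grow-< : ∀ {k} → suc k < q → grow k ≡ suc k
  grow-< (s≤s k<q-1) = m∸[m∸n]≡n k<q-1

  grow-last : ∀ {k} → suc k ≡ q → grow k ≡ k
  grow-last {k} refl = cong (k ∸_) (m≤n⇒m∸n≡0 (n≤1+n k))

  -- A maximiser of `f` among the indices below `k`. At `k = 0` the value 0 is a placeholder: the
  -- first comparison is of `f 0` with itself, and both outcomes give 0.
  lead : (ℕ → Carrier) → ℕ → ℕ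
  lead f zero    = 0
  lead f (suc k) = if does (f (lead f k) ≤ᴿ? f k) then k else lead f k

  module _ (f u : ℕ → Carrier) where
    -- The two options in state `k`: the best available column with the state kept, or column `k`
    -- with the state raised. In the last state `grow` is clamped, so the second option keeps the
    -- state too.
    stay grown : ℕ → Carrier
    stay  k = f (lead f (suc k)) +ᴿ u k
    grown k = f k +ᴿ u (grow k)

    grows : ℕ → Bool
    grows k = does (stay k ≤ᴿ? grown k)

    best : ℕ → Carrier
    best k = if grows k then grown k else stay k

    pick next-state : ℕ → ℕ
    pick       k = if grows k then k else lead f (suc k)
    next-state k = if grows k then grow k else k

  lead-≤ : ∀ (f : ℕ → Carrier) k → lead f (suc k) ≤ k
  lead-≤ f zero with f 0 ≤ᴿ? f 0
  ... | yes _ = z≤n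
  ... | no  _ = z≤n
  lead-≤ f (suc k) with f (lead f (suc k)) ≤ᴿ? f (suc k)
  ... | yes _ = ≤-refl
  ... | no  _ = m≤n⇒m≤1+n (lead-≤ f k)

  lead-max : ∀ (f : ℕ → Carrier) {j k} → j < k → f j ≤ᴿ f (lead f k)
  lead-max f {j} {suc k} (s≤s j≤k) with f (lead f k) ≤ᴿ? f k | m≤n⇒m<n∨m≡n j≤k
  ... | yes _  | inj₂ refl = ≤ᴿ-refl
  ... | yes le | inj₁ j<k  = ≤ᴿ-trans (lead-max f j<k) le
  ... | no  _  | inj₁ j<k  = lead-max f j<k
  ... | no ≰   | inj₂ refl with ≤ᴿ-total (f (lead f k)) (f k)
  ...   | inj₁ le = contradiction le ≰
  ...   | inj₂ ge = ge

  module _ (f u : ℕ → Carrier) where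
    pick-≤ : ∀ k → pick f u k ≤ k
    pick-≤ k with grows f u k
    ... | true  = ≤-refl
    ... | false = lead-≤ f k

    -- Growth in the last state is clamped and counts as the first case, so a real increase always
    -- comes with the choice of column `k`.
    next-state-cases : ∀ {k} → k < q →
      next-state f u k ≡ k ⊎ (pick f u k ≡ k × next-state f u k ≡ suc k × suc k < q)
    next-state-cases {k} k<q with grows f u k | m≤n⇒m<n∨m≡n k<q
    ... | false | _          = inj₁ refl
    ... | true  | inj₂ 1+k≡q = inj₁ (grow-last 1+k≡q)
    ... | true  | inj₁ 1+k<q = inj₂ (refl , grow-< 1+k<q , 1+k<q)

    best-attained : ∀ k → best f u k ≡ (f (pick f u k) +ᴿ u (next-state f u k))
    best-attained k with grows f u k
    ... | true  = refl
    ... | false = refl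

    stay≤best : ∀ k → stay f u k ≤ᴿ best f u k
    stay≤best k with stay f u k ≤ᴿ? grown f u k
    ... | yes le = le
    ... | no  _  = ≤ᴿ-refl

    grown≤best : ∀ k → grown f u k ≤ᴿ best f u k
    grown≤best k with stay f u k ≤ᴿ? grown f u k
    ... | yes _ = ≤ᴿ-refl
    ... | no ≰ with ≤ᴿ-total (stay f u k) (grown f u k)
    ...   | inj₁ le = contradiction le ≰
    ...   | inj₂ ge = ge

    best-stay : ∀ {j k} → j ≤ k → (f j +ᴿ u k) ≤ᴿ best f u k
    best-stay {j} {k} j≤k =
      ≤ᴿ-trans (+ᴿ-mono-≤ (lead-max f (s≤s j≤k)) ≤ᴿ-refl) (stay≤best k)

    best-grow : ∀ {k} → suc k < q → (f k +ᴿ u (suc k)) ≤ᴿ best f u k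
    best-grow {k} 1+k<q = subst (λ t → (f k +ᴿ u t) ≤ᴿ best f u k) (grow-< 1+k<q) (grown≤best k)

module DynamicProgram {c ℓ₁ ℓ₂} (ℝ : OrderedField c ℓ₁ ℓ₂) (p q : ℕ) (1≤q : 1 ≤ q)
  (D : ℕ → ℕ → OrderedField.Carrier ℝ) where
  open OrderedSums ℝ
  open Choice ℝ q

  -- value r i k: the best total of rows i, …, i + r − 1 when the columns
  -- 0, …, k are available to row i.
  value : ℕ → ℕ → ℕ → Carrier
  value zero    i k = 0#
  value (suc r) i k = best (D i) (value r (suc i)) k

  -- The table of optimal totals of the rows below row `i`; `from i` is the table with row `i`
  -- included.
  after : ℕ → ℕ → Carrier
  after i = value (p ∸ suc i) (suc i)

  from : ℕ → ℕ → Carrier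
  from i = value (p ∸ i) i

  from-step : ∀ {i} → i < p → ∀ k → from i k ≡ best (D i) (after i) k
  from-step {i} i<p k = cong (λ r → value r i k) (+-∸-assoc 1 i<p)

  -- The forward trace of the optimal choices: `level i` is the state on entering row `i`, `path i`
  -- the column chosen there.
  level path : ℕ → ℕ
  level zero    = 0
  level (suc i) = next-state (D i) (after i) (level i)
  path i = pick (D i) (after i) (level i)

  level-< : ∀ i → level i < q
  level-< zero = 1≤q
  level-< (suc i) with next-state-cases (D i) (after i) (level-< i)
  ... | inj₁ eq rewrite eq             = level-< i
  ... | inj₂ (_ , eq , 1+k<q) rewrite eq = 1+k<q

  path-≤ : ∀ i → path i ≤ level i
  path-≤ i = pick-≤ (D i) (after i) (level i)

  path-< : ∀ i → path i < q
  path-< i = ≤-<-trans (path-≤ i) (level-< i)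

  -- The level passes from `k` to `suc k` only when column `k` is chosen, so every column below the
  -- level has been used.
  level-used : ∀ {j} i → j < level i → ∃[ i′ ] (i′ < i × path i′ ≡ j)
  level-used {j} (suc i) j<k with next-state-cases (D i) (after i) (level-< i)
  ... | inj₁ eq with i′ , i′<i , eq′ ← level-used i (subst (j <_) eq j<k)
                = i′ , m<n⇒m<1+n i′<i , eq′
  ... | inj₂ (pick≡ , eq , _) with m≤n⇒m<n∨m≡n (s≤s⁻¹ (subst (j <_) eq j<k))
  ...   | inj₂ refl = i , n<1+n i , pick≡
  ...   | inj₁ j<k′ with i′ , i′<i , eq′ ← level-used i j<k′
                    = i′ , m<n⇒m<1+n i′<i , eq′

  path-restrictedGrowth : RestrictedGrowth p q path
  path-restrictedGrowth = record
    { bounded     = λ {i} _ → path-< i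
    -- A choice `suc j` is at most the level, so `j` is strictly below it and `level-used` applies.
    ; predecessor = λ {i} _ eq → level-used i (subst (_≤ level i) eq (path-≤ i))
    }

  -- Induction on the rows left, each step being `best-attained`; `i + r ≡ p` identifies
  -- `value r (suc i)` with `after i`.
  path-attains : ∀ r i → i + r ≡ p → total (λ i → D i (path i)) r i ≈ value r i (level i)
  path-attains zero    i _     = ≈-refl
  path-attains (suc r) i i+r≡p = begin-equality
    D i (path i) +ᴿ total (λ i → D i (path i)) r (suc i)
      ≈⟨ +ᴿ-cong ≈-refl (path-attains r (suc i) 1+i+r≡p) ⟩
    D i (path i) +ᴿ value r (suc i) (level (suc i))
      ≡⟨ cong (λ r → D i (path i) +ᴿ value r (suc i) (level (suc i))) r≡ ⟩
    D i (path i) +ᴿ after i (level (suc i))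
      ≡⟨ best-attained (D i) (after i) (level i) ⟨
    best (D i) (after i) (level i)
      ≡⟨ cong (λ r → value (suc r) i (level i)) r≡ ⟨
    value (suc r) i (level i) ∎
    where
    open ≤ᴿ-Reasoning
    1+i+r≡p : suc i + r ≡ p
    1+i+r≡p = trans (sym (+-suc i r)) i+r≡p
    r≡ : r ≡ p ∸ suc i
    r≡ = sym (trans (cong (_∸ suc i) (sym 1+i+r≡p)) (m+n∸m≡n (suc i) r))

  module _ {e} (rg : RestrictedGrowth p q e) where
    open RestrictedGrowth rg

    -- State `k` admits the right neighbour of every column used so far, as far as that neighbour
    -- exists.
    Available : ℕ → ℕ → Set
    Available i k = ∀ {i′} → i′ < i → suc (e i′) < q → suc (e i′) ≤ k

    available : ∀ {i k} → i < p → Available i k → e i ≤ k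
    available {i} i<p av with e i in ei
    ... | zero  = z≤n
    ... | suc j with i′ , i′<i , refl ← predecessor i<p ei =
      av i′<i (subst (_< q) ei (bounded i<p))

    Available-suc : ∀ {i k k′} → k ≤ k′ → Available i k → (suc (e i) < q → suc (e i) ≤ k′) →
                    Available (suc i) k′
    Available-suc k≤k′ av new {i′} (s≤s i′≤i) with m≤n⇒m<n∨m≡n i′≤i
    ... | inj₁ i′<i = λ lt → ≤-trans (av i′<i lt) k≤k′
    ... | inj₂ refl = new

    -- Every choice of `e` is an option of `best`: a column below `k` keeps the state, column `k`
    -- raises it, and the last column keeps it because nothing new becomes available.
    total≤value : ∀ r i k → i + r ≡ p → Available i k →
                  total (λ i → D i (e i)) r i ≤ᴿ value r i k
    total≤value zero    i k _     _  = ≤ᴿ-refl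
    total≤value (suc r) i k i+r≡p av with m≤n⇒m<n∨m≡n (available i<p av)
      where
      i<p : i < p
      i<p = subst (i <_) i+r≡p (m<m+n i z<s)
    ... | inj₁ e<k = ≤ᴿ-trans
      (+ᴿ-mono-≤ ≤ᴿ-refl (total≤value r (suc i) k (trans (sym (+-suc i r)) i+r≡p)
        (Available-suc ≤-refl av λ _ → e<k)))
      (best-stay (D i) (value r (suc i)) (<⇒≤ e<k))
    ... | inj₂ refl with suc (e i) <? q
    ...   | yes 1+e<q = ≤ᴿ-trans
      (+ᴿ-mono-≤ ≤ᴿ-refl (total≤value r (suc i) (suc (e i)) (trans (sym (+-suc i r)) i+r≡p)
        (Available-suc (n≤1+n _) av λ _ → ≤-refl)))
      (best-grow (D i) (value r (suc i)) 1+e<q)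
    ...   | no  1+e≮q = ≤ᴿ-trans
      (+ᴿ-mono-≤ ≤ᴿ-refl (total≤value r (suc i) (e i) (trans (sym (+-suc i r)) i+r≡p)
        (Available-suc ≤-refl av λ 1+e<q → contradiction 1+e<q 1+e≮q)))
      (best-stay (D i) (value r (suc i)) ≤-refl)

  pathVector : Vector ℝ p q
  pathVector i j _ = if code {p} {q} path i j then 1# else 0#

  -- `value p 0 0` is attained by `path` and bounds every vertex, hence by linearity every point of
  -- the orbitope.
  pathVector-optimal : ∀ d → (∀ i j .(j≤i : j Fin.≤ i) → D (toℕ i) (toℕ j) ≈ d i j j≤i) →
                       Optimal ℝ d pathVector
  pathVector-optimal d D≈d = (x̂ , x̂∈conv , λ _ _ _ → ≈-refl) , λ y y∈O → begin
    ⟨_,_⟩ ℝ d y                        ≤⟨ bound y y∈O ⟩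
    value p 0 0                        ≈⟨ path-attains p 0 refl ⟨
    total (λ i → D i (path i)) p 0     ≈⟨ code-value D D≈d path-restrictedGrowth x̂ (λ _ _ → ≈-refl) ⟨
    ⟨d, x̂ ⟩                            ≈⟨ restriction-value pathVector x̂ (λ _ _ _ → ≈-refl) ⟨
    ⟨_,_⟩ ℝ d pathVector               ∎
    where
    open ≤ᴿ-Reasoning
    open Objective ℝ d
    x̂ : Fin p × Fin q → Carrier
    x̂ (i , j) = if code {p} {q} path i j then 1# else 0#

    x̂∈conv : Conv ℝ (Vertex ℝ {p} {q}) x̂
    -- A convex combination of a single vertex with weight 1.
    x̂∈conv = 1 , (λ _ → 1#) , (λ _ → x̂) , (λ _ → 0≤1) , +ᴿ-identityʳ 1#
      , (λ _ → code path , restrictedGrowth⇒vertex ℝ path-restrictedGrowth , λ _ _ → ≈-refl)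
      , λ e → ≈-sym (≈-trans (+ᴿ-identityʳ _) (*ᴿ-identityˡ (x̂ e)))

    vertex-bound : ∀ v → Vertex ℝ v → ⟨d, v ⟩ ≤ᴿ value p 0 0
    vertex-bound v (M , isVertex , v≈) with e , rg , M≡ ← vertex⇒restrictedGrowth ℝ isVertex = begin
      ⟨d, v ⟩                       ≈⟨ code-value D D≈d rg v (λ i j → ≈-trans (v≈ i j)
                                         (reflexive (cong (λ b → if b then 1# else 0#) (M≡ i j)))) ⟩
      total (λ i → D i (e i)) p 0   ≤⟨ total≤value rg p 0 0 refl (λ ()) ⟩
      value p 0 0                   ∎

    bound : ∀ y → PartitioningOrbitope ℝ p q y → ⟨_,_⟩ ℝ d y ≤ᴿ value p 0 0
    bound y (ŷ , (n , w , v , 0≤w , Σw , vs , ŷ≈) , y≈) = begin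
      ⟨_,_⟩ ℝ d y                   ≈⟨ restriction-value y ŷ y≈ ⟩
      ⟨d, ŷ ⟩                       ≈⟨ combination-value w v ŷ ŷ≈ ⟩
      sum (λ k → w k *ᴿ ⟨d, v k ⟩)  ≤⟨ sum-weighted-≤ w _ 0≤w Σw (λ k → vertex-bound (v k) (vs k)) ⟩
      value p 0 0                   ∎

-- Program

scalar : ℕ → IntExp
scalar a = int a (nat 0)

assign : ℕ → IntExp → Program
assign a = setInt a (nat 0)

-- Each variable occupies entry 0 of an array of its own.  Natural numbers
-- cannot be multiplied, so offset = row * columns is maintained by additions
-- and subtractions.
rows columns row offset current leader picked following : IntExp
rows      = scalar 0
columns   = scalar 1
row       = scalar 2
offset    = scalar 3
current   = scalar 4
leader    = scalar 5
picked    = scalar 8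
following = scalar 9

at : IntExp → IntExp
at j = offset :+ j

-- The real array 2 holds the optimal totals of the rows below the current one.
objective tail : IntExp → RealExp
objective j = real 0 (at j)
tail      k = real 2 k

grownState : IntExp
grownState = (columns :∸ nat 1) :∸ ((columns :∸ nat 1) :∸ (nat 1 :+ current))

stayExp grownExp : RealExp
stayExp  = objective leader :+ tail current
grownExp = objective current :+ tail grownState

rowTest columnTest backwardTest leaderTest decideTest : Test
rowTest      = nat 1 :+ row :≤ rows
columnTest   = nat 1 :+ current :≤ columns
backwardTest = nat 1 :≤ row
leaderTest   = objective leader :≤ʳ objective current
decideTest   = stayExp :≤ʳ grownExp

-- The loop over the rows adds up `offset` to p q, where the backward pass starts. It also zeroes
-- the first `p` entries of the table, which include the `q` relevant ones because `q ≤ p`.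
clear nextRow zeroTail initialise : Program
clear      = assign 2 (nat 0) ⨾ assign 3 (nat 0)
nextRow    = assign 3 (columns :+ offset) ⨾ assign 2 (nat 1 :+ row)
zeroTail   = setReal 2 row zero ⨾ nextRow
initialise = clear ⨾ while rowTest zeroTail

updateLeader grown-choice stay-choice decide : Program
updateLeader = cond leaderTest (assign 5 current) skip
grown-choice = assign 8 current ⨾ assign 9 grownState ⨾ setReal 3 (nat 0) grownExp
stay-choice  = assign 8 leader  ⨾ assign 9 current    ⨾ setReal 3 (nat 0) stayExp
decide       = cond decideTest grown-choice stay-choice

-- The totals are overwritten in place: later states of this row only read
-- entries at their own position and above.
store : Program
store =
  setReal 2 current (real 3 (nat 0)) ⨾
  setInt 6 (at current) picked ⨾
  setInt 7 (at current) following ⨾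
  setReal 1 (at current) zero ⨾
  assign 4 (nat 1 :+ current)

enterRow inner backward : Program
enterRow =
  assign 2 (row :∸ nat 1) ⨾ assign 3 (offset :∸ columns) ⨾
  assign 4 (nat 0) ⨾ assign 5 (nat 0)
inner    = while columnTest (updateLeader ⨾ decide ⨾ store)
backward = while backwardTest (enterRow ⨾ inner)

-- The backward pass has already written the zeros of the output, so each row only needs its single
-- 1, found by following the recorded choices and states.
enterEmit emitRow emit program : Program
enterEmit = clear ⨾ assign 4 (nat 0)
emitRow   =
  setReal 1 (at (int 6 (at current))) one ⨾
  assign 4 (int 7 (at current)) ⨾ nextRow
emit      = enterEmit ⨾ while rowTest emitRow
program   = initialise ⨾ backward ⨾ emit

-- Straight-line programs and cost bounds

isStraight : Program → Bool
isStraight skip            = true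
isStraight (setInt _ _ _)  = true
isStraight (setReal _ _ _) = true
isStraight (P ⨾ Q)         = isStraight P ∧ isStraight Q
isStraight _               = false

-- The last clause is the cost of `skip`; for conditionals and loops, which `isStraight` excludes,
-- it is a placeholder.
straightCost : Program → ℕ
straightCost (setInt _ e f)  = 1 + (intCost e + intCost f)
straightCost (setReal _ e f) = 1 + (intCost e + realCost f)
straightCost (P ⨾ Q)         = straightCost P + straightCost Q
straightCost _               = 1

-- One round of a loop. Charging `suc n` rounds for `n` iterations pays for the final failing test.
loopCost : Test → ℕ → ℕ
loopCost b body = 1 + (testCost b + body)

-- A conditional is charged for both of its branches, which bounds either one.
updateLeaderCost decideCost columnCost : ℕ
updateLeaderCost = 1 + (testCost leaderTest + (straightCost (assign 5 current) + straightCost skip))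
decideCost       = 1 + (testCost decideTest + (straightCost grown-choice + straightCost stay-choice))
columnCost       = updateLeaderCost + (decideCost + straightCost store)

initialiseCost emitCost : ℕ → ℕ
initialiseCost p = straightCost clear + suc p * loopCost rowTest (straightCost zeroTail)
emitCost       p = straightCost enterEmit + suc p * loopCost rowTest (straightCost emitRow)

rowCost : ℕ → ℕ
rowCost q = straightCost enterRow + suc q * loopCost columnTest columnCost

backwardCost programCost : ℕ → ℕ → ℕ
backwardCost p q = suc p * loopCost backwardTest (rowCost q)
programCost  p q = initialiseCost p + (backwardCost p q + emitCost p)

-- Hoare triples with time bounds

module Hoare {c ℓ₁ ℓ₂} (ℝ : OrderedField c ℓ₁ ℓ₂) where
  open State public

  Assertion : Set _
  Assertion = State ℝ → Set c

  private variable
    A B C : Assertion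
    P Q   : Program
    m n   : ℕ

  -- Total correctness within `n` operations. An upper bound in place of the exact time lets
  -- branches of different cost share one triple.
  record Triple (A : Assertion) (P : Program) (n : ℕ) (B : Assertion) : Set c where
    field
      run : ∀ s → A s → Σ[ t ∈ ℕ ] Σ[ s′ ∈ State ℝ ] (Run ℝ P s t s′ × t ≤ n × B s′)
  open Triple public

  consequence : (∀ {s} → A s → B s) → Triple B P n C → Triple A P n C
  consequence A⇒B T .run s a = T .run s (A⇒B a)

  weaken : (∀ {s} → B s → C s) → Triple A P n B → Triple A P n C
  weaken B⇒C T .run s a with t , s′ , r , t≤n , b ← T .run s a = t , s′ , r , t≤n , B⇒C b

  exec : Program → State ℝ → State ℝ
  exec (setInt a e f)  s = record s { ints = update (ints s) a (evalInt ℝ s e) (evalInt ℝ s f) }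
  exec (setReal a e f) s = record s { reals = update (reals s) a (evalInt ℝ s e) (evalReal ℝ s f) }
  exec (P ⨾ Q)         s = exec Q (exec P s)
  exec _               s = s

  exec-run : ∀ P → T (isStraight P) → ∀ s → Run ℝ P s (straightCost P) (exec P s)
  exec-run skip            _ s = skip
  exec-run (setInt a e f)  _ s = setInt
  exec-run (setReal a e f) _ s = setReal
  exec-run (P ⨾ Q)         h s =
    exec-run P (proj₁ PQ) s ⨾ exec-run Q (proj₂ PQ) (exec P s)
    where PQ = Equivalence.to (T-∧ {isStraight P}) h

  ⟨straight⟩ : ∀ P {_ : T (isStraight P)} → (∀ {s} → A s → B (exec P s)) →
               Triple A P (straightCost P) B
  ⟨straight⟩ P {h} A⇒B .run s a = _ , _ , exec-run P h s , ≤-refl , A⇒B a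

  infixr 1 _⟨⨾⟩_
  _⟨⨾⟩_ : Triple A P m B → Triple B Q n C → Triple A (P ⨾ Q) (m + n) C
  (S ⟨⨾⟩ T) .run s a
    with t , s′ , r , t≤m , b ← S .run s a
    with u , s″ , r′ , u≤n , c ← T .run s′ b
    = t + u , s″ , (r ⨾ r′) , +-mono-≤ t≤m u≤n , c

  ⟨cond⟩ : ∀ {b} →
    Triple (λ s → A s × evalTest ℝ s b ≡ true)  P m B →
    Triple (λ s → A s × evalTest ℝ s b ≡ false) Q n B →
    Triple A (cond b P Q) (1 + (testCost b + (m + n))) B
  ⟨cond⟩ {m = m} {n = n} {b = b} S T .run s a with evalTest ℝ s b in eq
  ... | true  with t , s′ , r , t≤m , B ← S .run s (a , eq) =
    _ , s′ , cond-true eq r ,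
    s≤s (+-monoʳ-≤ (testCost b) (≤-trans t≤m (m≤m+n m n))) , B
  ... | false with t , s′ , r , t≤n , B ← T .run s (a , eq) =
    _ , s′ , cond-false eq r ,
    s≤s (+-monoʳ-≤ (testCost b) (≤-trans t≤n (m≤n+m n m))) , B

  -- The index of the invariant is the exact number of iterations left; it decides the test and
  -- yields termination.
  ⟨while-down⟩ : ∀ {b} (I : ℕ → Assertion) →
    (∀ {k s} → I k s → evalTest ℝ s b ≡ does (1 ≤? k)) → ∀ k →
    (∀ {j} → j < k → Triple (I (suc j)) P m (I j)) →
    Triple (I k) (while b P) (suc k * loopCost b m) (I 0)
  ⟨while-down⟩ {m = m} {b = b} I test zero body .run s i =
    _ , s , while-false (test i) ,
    s≤s (≤-trans (m≤m+n (testCost b) m) (m≤m+n (testCost b + m) 0)) , i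
  ⟨while-down⟩ {m = m} {b = b} I test (suc k) body .run s i
    with t , s′ , r , t≤m , i′ ← body (n<1+n k) .run s i
    with u , s″ , r′ , u≤ , i″ ← ⟨while-down⟩ I test k (λ j<k → body (m<n⇒m<1+n j<k)) .run s′ i′
    = _ , s″ , while-true (test i) r r′ , bound , i″
    where
    bound : 1 + (testCost b + (t + u)) ≤ suc (suc k) * loopCost b m
    bound = s≤s (≤-trans
      (≤-reflexive (sym (+-assoc (testCost b) t u)))
      (+-mono-≤ (+-monoʳ-≤ (testCost b) t≤m) u≤))

  -- `J` hides the rising counter behind the number of iterations left, which reduces the claim to
  -- `⟨while-down⟩`.
  ⟨while-up⟩ : ∀ {b} (I : ℕ → Assertion) n →
    (∀ {k s} → I k s → evalTest ℝ s b ≡ does (suc k ≤? n)) →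
    (∀ {k} → k < n → Triple (I k) P m (I (suc k))) →
    Triple (I 0) (while b P) (suc n * loopCost b m) (I n)
  ⟨while-up⟩ {P = P} {m = m} {b = b} I n test body =
    consequence (λ i → 0 , refl , i) (weaken finish (⟨while-down⟩ J testJ n bodyJ))
    where
    J : ℕ → Assertion
    J left s = Σ[ k ∈ ℕ ] (k + left ≡ n × I k s)
    finish : ∀ {s} → J 0 s → I n s
    finish {s} (k , eq , i) = subst (λ k → I k s) (trans (sym (+-identityʳ k)) eq) i
    testJ : ∀ {left s} → J left s → evalTest ℝ s b ≡ does (1 ≤? left)
    testJ {zero}     (k , eq , i) = trans (test i) (dec-false (suc k ≤? n)
      (λ k<n → <-irrefl (trans (sym (+-identityʳ k)) eq) k<n))
    testJ {suc left} (k , eq , i) = trans (test i) (dec-true (suc k ≤? n)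
      (subst (k <_) eq (m<m+n k z<s)))
    bodyJ : ∀ {left} → left < n → Triple (J (suc left)) P m (J left)
    bodyJ {left} _ .run s (k , eq , i)
      with t , s′ , r , t≤ , i′ ← body (subst (k <_) eq (m<m+n k z<s)) .run s i
      = t , s′ , r , t≤ , suc k , trans (sym (+-suc k left)) eq , i′

-- Reading updated memory

if-≡ᵇ : ∀ {a} {A : Set a} {m n} {x y : A} → m ≡ n → (if m ≡ᵇ n then x else y) ≡ x
if-≡ᵇ {m = m} {n} m≡n rewrite ≡⇒≡ᵇ-true {m} {n} m≡n = refl

if-≢ᵇ : ∀ {a} {A : Set a} {m n} {x y : A} → m ≢ n → (if m ≡ᵇ n then x else y) ≡ y
if-≢ᵇ {m = m} {n} m≢n rewrite ≢⇒≡ᵇ-false {m} {n} m≢n = refl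

if-true : ∀ {a} {A : Set a} {b} {x y : A} → b ≡ true → (if b then x else y) ≡ x
if-true refl = refl

if-false : ∀ {a} {A : Set a} {b} {x y : A} → b ≡ false → (if b then x else y) ≡ y
if-false refl = refl

-- Loop invariants and correctness of the program

module Correctness {c ℓ₁ ℓ₂} (ℝ : OrderedField c ℓ₁ ℓ₂) (p q : ℕ) (1≤q : 1 ≤ q) (q≤p : q ≤ p)
  (D : ℕ → ℕ → OrderedField.Carrier ℝ) where
  open OrderedSums ℝ
  open Choice ℝ q
  open DynamicProgram ℝ p q 1≤q D
  open Hoare ℝ

  -- Row-major positions of different rows differ, so a write in one row leaves the entries of the
  -- others intact.
  position-< : ∀ {i i′ k k′} → i < i′ → k < q → i * q + k < i′ * q + k′
  position-< {i} {i′} {k} {k′} i<i′ k<q = begin-strict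
    i * q + k    <⟨ +-monoʳ-< (i * q) k<q ⟩
    i * q + q    ≡⟨ +-comm (i * q) q ⟩
    suc i * q    ≤⟨ *-monoˡ-≤ q i<i′ ⟩
    i′ * q       ≤⟨ m≤m+n (i′ * q) k′ ⟩
    i′ * q + k′  ∎
    where open ≤-Reasoning

  record Common (i : ℕ) (s : State ℝ) : Set c where
    field
      rows≡    : ints s 0 0 ≡ p
      columns≡ : ints s 1 0 ≡ q
      row≡     : ints s 2 0 ≡ i
      offset≡    : ints s 3 0 ≡ i * q
      input    : ∀ i j → reals s 0 (i * q + j) ≡ D i j

    objective≡ : ∀ e {k} → evalInt ℝ s e ≡ k → evalReal ℝ s (objective e) ≡ D i k
    objective≡ e {k} e≡k = trans (cong (reals s 0) (cong₂ _+_ offset≡ e≡k)) (input i k)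
  open Common

  record Recorded (s : State ℝ) (i k : ℕ) : Set c where
    constructor recorded
    field
      pick≡  : ints s 6 (i * q + k) ≡ pick (D i) (after i) k
      next≡  : ints s 7 (i * q + k) ≡ next-state (D i) (after i) k
      blank  : reals s 1 (i * q + k) ≡ 0#
  open Recorded

  RecordedFrom : ℕ → State ℝ → Set c
  RecordedFrom i s = ∀ i′ k → i ≤ i′ → i′ < p → k < q → Recorded s i′ k

  Initial : ℕ → Assertion
  Initial i s = Common i s × (∀ k → k < i → reals s 2 k ≡ 0#)

  Outer : ℕ → Assertion
  Outer i s = Common i s × (∀ k → k < q → reals s 2 k ≡ from i k) × RecordedFrom i s

  -- Within row `i` the table in real array 2 is split at `k`: finished totals of this row before
  -- it, totals of the rows below from it on.
  record Inner (i l k : ℕ) (s : State ℝ) : Set c where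
    field
      common   : Common i s
      current≡ : ints s 4 0 ≡ k
      leader≡  : ints s 5 0 ≡ l
      new      : ∀ k′ → k′ < k → reals s 2 k′ ≡ best (D i) (after i) k′
      old      : ∀ k′ → k ≤ k′ → k′ < q → reals s 2 k′ ≡ after i k′
      this-row : ∀ k′ → k′ < k → Recorded s i k′
      below    : RecordedFrom (suc i) s
  open Inner

  Decided : ℕ → ℕ → Assertion
  Decided i k s = Inner i (lead (D i) (suc k)) k s
    × ints s 8 0 ≡ pick (D i) (after i) k
    × ints s 9 0 ≡ next-state (D i) (after i) k
    × reals s 3 0 ≡ best (D i) (after i) k

  -- Rows before `i` hold their final output, while `RecordedFrom i` says that the later ones are
  -- still blank.
  Emitted : ℕ → Assertion
  Emitted i s = Common i s × ints s 4 0 ≡ level i × RecordedFrom i s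
    × (∀ i′ j → i′ < i → j < q → reals s 1 (i′ * q + j) ≡ (if j ≡ᵇ path i′ then 1# else 0#))

  test-row : ∀ {i s} → Common i s → evalTest ℝ s rowTest ≡ does (suc i ≤? p)
  test-row C = cong₂ (λ m n → does (suc m ≤? n)) (row≡ C) (rows≡ C)

  Start : Assertion
  Start s = ints s 0 0 ≡ p × ints s 1 0 ≡ q × (∀ i j → reals s 0 (i * q + j) ≡ D i j)

  ⟨initialise⟩ : Triple Start initialise (initialiseCost p) (Initial p)
  ⟨initialise⟩ = ⟨straight⟩ clear start ⟨⨾⟩
    ⟨while-up⟩ Initial p (λ (C , _) → test-row C) (λ _ → ⟨straight⟩ zeroTail step)
    where
    start : ∀ {s} → Start s → Initial 0 (exec clear s)
    start (r , c , inp) =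
      record { rows≡ = r ; columns≡ = c ; row≡ = refl ; offset≡ = refl ; input = inp } , λ _ ()
    step : ∀ {i s} → Initial i s → Initial (suc i) (exec zeroTail s)
    step {i} {s} (C , z) =
      record { rows≡ = rows≡ C ; columns≡ = columns≡ C ; row≡ = cong suc (row≡ C)
             ; offset≡ = cong₂ _+_ (columns≡ C) (offset≡ C) ; input = input C }
      , zeros
      where
      zeros : ∀ k → k < suc i → (if ints s 2 0 ≡ᵇ k then 0# else reals s 2 k) ≡ 0#
      zeros k k<1+i with m≤n⇒m<n∨m≡n (s≤s⁻¹ k<1+i)
      ... | inj₁ k<i  = trans (if-≢ᵇ λ eq → <-irrefl (trans (sym eq) (row≡ C)) k<i) (z k k<i)
      ... | inj₂ refl = if-≡ᵇ (row≡ C)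

  initial⇒outer : ∀ {s} → Initial p s → Outer p s
  -- No rows lie at or beyond `p`, so the table is zero and there is nothing recorded yet.
  initial⇒outer (C , z) = C , (λ k k<q → trans (z k (<-≤-trans k<q q≤p)) (from-p k)) ,
    λ i′ k p≤i′ i′<p → contradiction i′<p (≤⇒≯ p≤i′)
    where
    from-p : ∀ k → 0# ≡ from p k
    from-p k rewrite n∸n≡0 p = refl

  grownState≡ : ∀ {i l k s} → Inner i l k s → evalInt ℝ s grownState ≡ grow k
  grownState≡ I = cong₂ (λ q k → (q ∸ 1) ∸ ((q ∸ 1) ∸ suc k)) (columns≡ (common I)) (current≡ I)

  stay≡ : ∀ {i k s} → k < q → Inner i (lead (D i) (suc k)) k s →
          evalReal ℝ s stayExp ≡ stay (D i) (after i) k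
  stay≡ {i} {k} {s} k<q I = cong₂ _+ᴿ_ (objective≡ (common I) leader (leader≡ I))
    (trans (cong (reals s 2) (current≡ I)) (old I k ≤-refl k<q))

  -- The table is read at `grow k` only in the part not yet overwritten.
  grow≥ : ∀ {k} → k < q → k ≤ grow k × grow k < q
  grow≥ {k} k<q with m≤n⇒m<n∨m≡n k<q
  ... | inj₁ 1+k<q rewrite grow-< 1+k<q = n≤1+n k , 1+k<q
  ... | inj₂ 1+k≡q rewrite grow-last 1+k≡q = ≤-refl , k<q

  grown≡ : ∀ {i l k s} → k < q → Inner i l k s → evalReal ℝ s grownExp ≡ grown (D i) (after i) k
  grown≡ {i} {l} {k} {s} k<q I = cong₂ _+ᴿ_ (objective≡ (common I) current (current≡ I))
    (trans (cong (reals s 2) (grownState≡ I)) (old I (grow k) (proj₁ (grow≥ k<q)) (proj₂ (grow≥ k<q))))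

  ⟨updateLeader⟩ : ∀ {i k} → Triple (Inner i (lead (D i) k) k) updateLeader updateLeaderCost
                                    (Inner i (lead (D i) (suc k)) k)
  ⟨updateLeader⟩ {i} {k} = ⟨cond⟩ (⟨straight⟩ (assign 5 current) take) (⟨straight⟩ skip keep)
    where
    A = Inner i (lead (D i) k) k
    B = Inner i (lead (D i) (suc k)) k
    test≡ : ∀ {s} → A s → evalTest ℝ s leaderTest ≡ does (D i (lead (D i) k) ≤ᴿ? D i k)
    test≡ I = cong₂ (λ x y → does (x ≤ᴿ? y))
      (objective≡ (common I) leader (leader≡ I)) (objective≡ (common I) current (current≡ I))
    take : ∀ {s} → A s × evalTest ℝ s leaderTest ≡ true → B (exec (assign 5 current) s)
    take (I , eq) = record
      -- Array names are literals, so reads of the other arrays compute to the old reads; the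
      -- records are rebuilt field by field for the new state.
      { common = record { Common (common I) } ; current≡ = current≡ I
      ; leader≡ = trans (current≡ I) (sym (if-true (trans (sym (test≡ I)) eq)))
      ; new = new I ; old = old I
      ; this-row = λ k′ k′<k → record { Recorded (this-row I k′ k′<k) }
      ; below = λ i′ k′ i<i′ i′<p k′<q → record { Recorded (below I i′ k′ i<i′ i′<p k′<q) } }
    keep : ∀ {s} → A s × evalTest ℝ s leaderTest ≡ false → B s
    keep (I , eq) = record
      { Inner I ; leader≡ = trans (leader≡ I) (sym (if-false (trans (sym (test≡ I)) eq))) }

  ⟨decide⟩ : ∀ {i k} → k < q → Triple (Inner i (lead (D i) (suc k)) k) decide decideCost (Decided i k)
  ⟨decide⟩ {i} {k} k<q =
    ⟨cond⟩ (⟨straight⟩ grown-choice choose-grown) (⟨straight⟩ stay-choice choose-stay)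
    where
    A = Inner i (lead (D i) (suc k)) k
    test≡ : ∀ {s} → A s → evalTest ℝ s decideTest ≡ grows (D i) (after i) k
    test≡ I = cong₂ (λ x y → does (x ≤ᴿ? y)) (stay≡ k<q I) (grown≡ k<q I)
    decided : ∀ {s a b x} → A s → a ≡ pick (D i) (after i) k → b ≡ next-state (D i) (after i) k →
      x ≡ best (D i) (after i) k →
      Decided i k (record { ints  = update (update (ints s) 8 0 a) 9 0 b
                          ; reals = update (reals s) 3 0 x })
    decided I a b x = record
      { common = record { Common (common I) } ; current≡ = current≡ I ; leader≡ = leader≡ I
      ; new = new I ; old = old I
      ; this-row = λ k′ k′<k → record { Recorded (this-row I k′ k′<k) }
      ; below = λ i′ k′ i<i′ i′<p k′<q → record { Recorded (below I i′ k′ i<i′ i′<p k′<q) } }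
      , a , b , x
    choose-grown : ∀ {s} → A s × evalTest ℝ s decideTest ≡ true → Decided i k (exec grown-choice s)
    choose-grown (I , eq) = decided I
      (trans (current≡ I) (sym (if-true grows≡)))
      (trans (grownState≡ I) (sym (if-true grows≡)))
      (trans (grown≡ k<q I) (sym (if-true grows≡)))
      where grows≡ = trans (sym (test≡ I)) eq
    choose-stay : ∀ {s} → A s × evalTest ℝ s decideTest ≡ false → Decided i k (exec stay-choice s)
    choose-stay (I , eq) = decided I
      (trans (leader≡ I) (sym (if-false grows≡)))
      (trans (current≡ I) (sym (if-false grows≡)))
      (trans (stay≡ k<q I) (sym (if-false grows≡)))
      where grows≡ = trans (sym (test≡ I)) eq

  ⟨store⟩ : ∀ {i k} → k < q → Triple (Decided i k) store (straightCost store) (Inner i (lead (D i) (suc k)) (suc k))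
  ⟨store⟩ {i} {k} k<q = ⟨straight⟩ store stored
    where
    stored : ∀ {s} → Decided i k s → Inner i (lead (D i) (suc k)) (suc k) (exec store s)
    stored {s} (I , pick≡k , next≡k , best≡k) = record
      { common   = record { Common (common I) }
      ; current≡ = cong suc (current≡ I)
      ; leader≡  = leader≡ I
      ; new      = new′
      ; old      = λ k′ k<k′ k′<q →
          trans (if-≢ᵇ λ eq → <⇒≢ k<k′ (trans (sym (current≡ I)) eq)) (old I k′ (<⇒≤ k<k′) k′<q)
      ; this-row = this-row′
      ; below    = λ i′ k′ i<i′ i′<p k′<q →
          keep (λ eq → <⇒≢ (position-< i<i′ k<q) eq) (below I i′ k′ i<i′ i′<p k′<q)
      }
      where
      position : ints s 3 0 + ints s 4 0 ≡ i * q + k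
      position = cong₂ _+_ (offset≡ (common I)) (current≡ I)
      keep : ∀ {i′ k′} → i * q + k ≢ i′ * q + k′ → Recorded s i′ k′ → Recorded (exec store s) i′ k′
      keep {i′} {k′} apart r = recorded (trans (if-≢ᵇ apart′) (pick≡ r)) (trans (if-≢ᵇ apart′) (next≡ r))
                                    (trans (if-≢ᵇ apart′) (blank r))
        where
        apart′ : ints s 3 0 + ints s 4 0 ≢ i′ * q + k′
        apart′ eq = apart (trans (sym position) eq)
      new′ : ∀ k′ → k′ < suc k → reals (exec store s) 2 k′ ≡ best (D i) (after i) k′
      new′ k′ k′<1+k with m≤n⇒m<n∨m≡n (s≤s⁻¹ k′<1+k)
      ... | inj₁ k′<k = trans (if-≢ᵇ λ eq → <⇒≢ k′<k (trans (sym eq) (current≡ I))) (new I k′ k′<k)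
      ... | inj₂ refl = trans (if-≡ᵇ (current≡ I)) best≡k
      this-row′ : ∀ k′ → k′ < suc k → Recorded (exec store s) i k′
      this-row′ k′ k′<1+k with m≤n⇒m<n∨m≡n (s≤s⁻¹ k′<1+k)
      ... | inj₁ k′<k = keep (λ eq → <⇒≢ k′<k (sym (+-cancelˡ-≡ (i * q) k k′ eq))) (this-row I k′ k′<k)
      ... | inj₂ refl = recorded (trans (if-≡ᵇ position) pick≡k) (trans (if-≡ᵇ position) next≡k)
                                 (if-≡ᵇ position)

  ⟨column⟩ : ∀ {i k} → k < q →
    Triple (Inner i (lead (D i) k) k) (updateLeader ⨾ decide ⨾ store) columnCost
           (Inner i (lead (D i) (suc k)) (suc k))
  ⟨column⟩ k<q = ⟨updateLeader⟩ ⟨⨾⟩ ⟨decide⟩ k<q ⟨⨾⟩ ⟨store⟩ k<q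

  ⟨inner⟩ : ∀ {i} → Triple (Inner i 0 0) inner (suc q * loopCost columnTest columnCost) (Inner i (lead (D i) q) q)
  ⟨inner⟩ {i} = ⟨while-up⟩ {m = columnCost} (λ k → Inner i (lead (D i) k) k) q
    (λ I → cong₂ (λ k q → does (suc k ≤? q)) (current≡ I) (columns≡ (common I))) ⟨column⟩

  ⟨row⟩ : ∀ {i} → i < p → Triple (Outer (suc i)) (enterRow ⨾ inner) (rowCost q) (Outer i)
  ⟨row⟩ i<p = ⟨straight⟩ enterRow enter ⟨⨾⟩ weaken (leave i<p) ⟨inner⟩
    where
    enter : ∀ {i s} → Outer (suc i) s → Inner i 0 0 (exec enterRow s)
    enter {i} (C , values , rec) = record
      { common = record
        { rows≡ = rows≡ C ; columns≡ = columns≡ C ; row≡ = cong (_∸ 1) (row≡ C)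
        ; offset≡ = trans (cong₂ _∸_ (offset≡ C) (columns≡ C)) (m+n∸m≡n q (i * q)) ; input = input C }
      -- `from (suc i)` and `after i` agree by definition, so the finished table of row `suc i`
      -- serves as the old table of row `i`.
      ; current≡ = refl ; leader≡ = refl ; new = λ _ () ; old = λ k′ _ → values k′
      ; this-row = λ _ ()
      ; below = λ i′ k′ i<i′ i′<p k′<q → record { Recorded (rec i′ k′ i<i′ i′<p k′<q) } }
    leave : ∀ {i l s} → i < p → Inner i l q s → Outer i s
    leave {i} {l} {s} i<p I = common I , (λ k k<q → trans (new I k k<q) (sym (from-step i<p k))) , rec
      where
      rec : RecordedFrom i s
      rec i′ k i≤i′ i′<p k<q with m≤n⇒m<n∨m≡n i≤i′
      ... | inj₁ i<i′ = below I i′ k i<i′ i′<p k<q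
      ... | inj₂ refl = this-row I k k<q

  ⟨backward⟩ : Triple (Outer p) backward (backwardCost p q) (Outer 0)
  ⟨backward⟩ = ⟨while-down⟩ {m = rowCost q} Outer (λ (C , _) → cong (λ i → does (1 ≤? i)) (row≡ C)) p ⟨row⟩

  ⟨emit⟩ : Triple (Outer 0) emit (emitCost p) (Emitted p)
  ⟨emit⟩ = ⟨straight⟩ enterEmit start ⟨⨾⟩
    ⟨while-up⟩ Emitted p (λ (C , _) → test-row C) (λ i<p → ⟨straight⟩ emitRow (step i<p))
    where
    start : ∀ {s} → Outer 0 s → Emitted 0 (exec enterEmit s)
    start (C , _ , rec) =
      record { rows≡ = rows≡ C ; columns≡ = columns≡ C ; row≡ = refl ; offset≡ = refl ; input = input C }
      , refl , (λ i′ k′ i<i′ i′<p k′<q → record { Recorded (rec i′ k′ i<i′ i′<p k′<q) }) , λ _ _ ()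
    step : ∀ {i s} → i < p → Emitted i s → Emitted (suc i) (exec emitRow s)
    step {i} {s} i<p (C , current≡ , rec , written) =
      record { rows≡ = rows≡ C ; columns≡ = columns≡ C ; row≡ = cong suc (row≡ C)
             ; offset≡ = cong₂ _+_ (columns≡ C) (offset≡ C) ; input = input C }
      , trans (cong (ints s 7) here) (next≡ now)
      -- The 1 is written in row `i`, so later rows stay blank.
      , (λ i′ k′ i<i′ i′<p k′<q → let r = rec i′ k′ (<⇒≤ i<i′) i′<p k′<q in
          recorded (pick≡ r) (next≡ r) (trans (if-≢ᵇ λ eq →
            <⇒≢ (position-< i<i′ (path-< i)) (trans (sym target) eq)) (blank r)))
      , written′
      where
      now : Recorded s i (level i)
      now = rec i (level i) ≤-refl i<p (level-< i)
      here : ints s 3 0 + ints s 4 0 ≡ i * q + level i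
      here = cong₂ _+_ (offset≡ C) current≡
      target : ints s 3 0 + ints s 6 (ints s 3 0 + ints s 4 0) ≡ i * q + path i
      target = cong₂ _+_ (offset≡ C) (trans (cong (ints s 6) here) (pick≡ now))
      written′ : ∀ i′ j → i′ < suc i → j < q →
        reals (exec emitRow s) 1 (i′ * q + j) ≡ (if j ≡ᵇ path i′ then 1# else 0#)
      written′ i′ j i′<1+i j<q with m≤n⇒m<n∨m≡n (s≤s⁻¹ i′<1+i)
      ... | inj₁ i′<i = trans
        (if-≢ᵇ λ eq → <⇒≢ (position-< i′<i j<q) (trans (sym eq) target))
        (written i′ j i′<i j<q)
      ... | inj₂ refl with j ≟ path i
      ...   | yes j≡   = trans (if-≡ᵇ (trans target (cong (i * q +_) (sym j≡)))) (sym (if-≡ᵇ j≡))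
      ...   | no  j≢   = trans
        (if-≢ᵇ λ eq → j≢ (sym (+-cancelˡ-≡ (i * q) (path i) j (trans (sym target) eq))))
        (trans (blank (rec i j ≤-refl i<p j<q)) (sym (if-≢ᵇ j≢)))

  ⟨program⟩ : Triple Start program (programCost p q) (Emitted p)
  ⟨program⟩ = weaken initial⇒outer ⟨initialise⟩ ⟨⨾⟩ ⟨backward⟩ ⟨⨾⟩ ⟨emit⟩

-- Running time

O[pq] : (ℕ → ℕ → ℕ) → Set
O[pq] f = Σ[ C ∈ ℕ ] (∀ p q → 1 ≤ p → 1 ≤ q → f p q ≤ C * (p * q))

O-constant : ∀ a → O[pq] (λ _ _ → a)
O-constant a = a , λ p q 1≤p 1≤q → m≤m*n a (p * q) {{>-nonZero (*-mono-≤ 1≤p 1≤q)}}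

infixr 6 _O-+_
_O-+_ : ∀ {f g} → O[pq] f → O[pq] g → O[pq] (λ p q → f p q + g p q)
(C , f≤) O-+ (C′ , g≤) = C + C′ , λ p q 1≤p 1≤q →
  ≤-trans (+-mono-≤ (f≤ p q 1≤p 1≤q) (g≤ p q 1≤p 1≤q)) (≤-reflexive (sym (*-distribʳ-+ (p * q) C C′)))

-- For positive `p` and `q`, `suc p ≤ p + p`, `suc q ≤ q + q` and `a ≤ a * q`, which gives the
-- constant 2 (a + 2 b).
O-nested : ∀ a b → O[pq] (λ p q → suc p * (a + suc q * b))
O-nested a b = (a + (b + b)) + (a + (b + b)) , bound
  where
  rearrange : ∀ p q a b → (p + p) * (a * q + (q + q) * b) ≡ (a + (b + b) + (a + (b + b))) * (p * q)
  rearrange = solve-∀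
  bound : ∀ p q → 1 ≤ p → 1 ≤ q →
          suc p * (a + suc q * b) ≤ (a + (b + b) + (a + (b + b))) * (p * q)
  bound p q 1≤p 1≤q = begin
    suc p * (a + suc q * b)                    ≤⟨ *-mono-≤ (+-monoˡ-≤ p 1≤p) (+-mono-≤
                                                    (m≤m*n a q {{>-nonZero 1≤q}})
                                                    (*-monoˡ-≤ b (+-monoˡ-≤ q 1≤q))) ⟩
    (p + p) * (a * q + (q + q) * b)            ≡⟨ rearrange p q a b ⟩
    (a + (b + b) + (a + (b + b))) * (p * q)    ∎
    where open ≤-Reasoning

O-rows : ∀ a → O[pq] (λ p _ → suc p * a)
O-rows a with C , bound ← O-nested a 0 = C , λ p q 1≤p 1≤q →
  ≤-trans (*-monoʳ-≤ (suc p) (m≤m+n a (suc q * 0))) (bound p q 1≤p 1≤q)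

program-O[pq] : O[pq] programCost
program-O[pq] =
  (O-constant (straightCost clear) O-+ O-rows (loopCost rowTest (straightCost zeroTail))) O-+
  O-nested (loopCost backwardTest (straightCost enterRow)) (loopCost columnTest columnCost) O-+
  (O-constant (straightCost enterEmit) O-+
   O-rows (loopCost rowTest (straightCost emitRow)))

-- Linear optimization over the orbitope in time O(p q)

corollary9 : ∀ {c ℓ₁ ℓ₂} (ℝ : OrderedField c ℓ₁ ℓ₂) →
    Σ[ P ∈ Program ] Σ[ C ∈ ℕ ]
    (∀ p q → 1 ≤ q → q ≤ p → (d : Vector ℝ p q) →
    ∀ s → Input ℝ p q d s →
    Σ[ t ∈ ℕ ] Σ[ s′ ∈ State ℝ ] Σ[ x ∈ Vector ℝ p q ]
    Run ℝ P s t s′ × t ≤ C * (p * q) × Output ℝ p q x s′ × Optimal ℝ d x)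
corollary9 ℝ = program , proj₁ program-O[pq] , λ p q 1≤q q≤p d s input →
  let open OrderedSums ℝ
      -- `D` reads memory at every position, whatever is stored there, so `Start` holds by `refl`;
      -- agreement with `d` enters only through `Input.objective`.
      D i j = State.reals s 0 (i * q + j)
      open DynamicProgram ℝ p q 1≤q D
      open Correctness ℝ p q 1≤q q≤p D
      t , s′ , r , t≤ , (_ , _ , _ , written) = Hoare.Triple.run ⟨program⟩ s
        (Input.rows input , Input.columns input , λ _ _ → refl)
  in t , s′ , pathVector , r
   , ≤-trans t≤ (proj₂ program-O[pq] p q (≤-trans 1≤q q≤p) 1≤q)
   , (λ i j _ → reflexive (written (toℕ i) (toℕ j) (Fin.toℕ<n i) (Fin.toℕ<n j)))
   , pathVector-optimal d (Input.objective input)
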